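{- The analogical proportion relation defined below satisfies the following properties, for all $L$-structures $\mathfrak A,\mathfrak B$: \begin{itemize} \item (p-symmetry) for all $a,b\in A$, $c,d\in B$: $(\mathfrak A,\mathfrak B)\models a:b::c:d$ iff $(\mathfrak B,\mathfrak A)\models c:d::a:b$; \item (inner p-symmetry) for all $a,b\in A$, $c,d\in B$: $(\mathfrak A,\mathfrak B)\models a:b::c:d$ iff $(\mathfrak A,\mathfrak B)\models b:a::d:c$; \item (inner p-reflexivity) for all $a\in A$, $c\in B$: $(\mathfrak A,\mathfrak B)\models a:a::c:c$; \item (p-reflexivity) for all $a,b\in A$: $\mathfrak A\models a:b::a:b$; \item (p-determinism) for all $a,d\in A$: $\mathfrak A\models a:a::a:d$ iff $d=a$. \end{itemize} Moreover, each of the following properties fails in general (i.e. for each there exist a language $L$, $L$-structures and elements violating it): \begin{itemize} \item (central permutation) $\mathfrak A\models a:b::c:d \Leftrightarrow \mathfrak A\models a:c::b:d$; \item (strong inner p-reflexivity) $\mathfrak A\models a:a::c:d \Rightarrow d=c$; \item (strong p-reflexivity) $\mathfrak A\models a:b::a:d\Rightarrow d=b$; \item (p-commutativity) $\mathfrak A\models a:b::b:a$ for all $a,b\in A$; \item (p-transitivity) $(\mathfrak A,\mathfrak B)\models a:b::c:d$ and $(\mathfrak B,\mathfrak C)\models c:d::e:f$ imply $(\mathfrak A,\mathfrak C)\models a:b::e:f$ (for $a,b\in A$, $c,d\in B$, $e,f\in C$); \item (inner p-transitivity) $(\mathfrak A,\mathfrak B)\models a:b::c:d$ and $(\mathfrak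 A,\mathfrak B)\models b:e::d:f$ imply $(\mathfrak A,\mathfrak B)\models a:e::c:f$ (for $a,b,e\in A$, $c,d,f\in B$); \item (central p-transitivity) $(\mathfrak A,\mathfrak B)\models a:b::b:c$ and $(\mathfrak B,\mathfrak C)\models b:c::c:d$ imply $(\mathfrak A,\mathfrak C)\models a:b::c:d$ (for $a\in A$, $b\in A\cap B$, $c\in B\cap C$, $d\in C$). \end{itemize}
   Context: Let $L$ be a first-order language (relation, function and constant symbols; equality always available). A conjunctive $L$-formula is an $L$-formula built from atomic formulas using only $\wedge$ and the quantifiers $\exists,\forall$ (no negation, no disjunction); distinct quantifiers bind distinct variables. For a conjunctive formula $\alpha$ whose free variables are exactly $x$ and $y$, its dependency graph is the undirected graph whose vertices are all variables occurring in $\alpha$, with an edge $\{w,z\}$ iff $w$ and $z$ occur together in some atomic subformula of $\alpha$. A connected formula (c-formula) is a conjunctive formula with free variables exactly $x,y$ whose dependency graph is connected. For an $L$-structure $\mathfrak A$ and $a,b\in A$, put $\uparrow_{\mathfrak A}(a\to b)=\{\alpha \text{ c-formula}: \mathfrak A\models\alpha(a,b)\}$; for $L$-structures $\mathfrak A,\mathfrak B$, $a,b\in A$, $c,d\in B$, put $\uparrow_{(\mathfrak A,\mathfrak B)}(a\to b:\cdot\, c\to d)=\uparrow_{\mathfrak A}(a\to b)\cap\uparrow_{\mathfrak B}(c\to d)$ (its elements are called justifications). A c-formula is trivial in $(\mathfrak A,\mathfrak B)$ iff it lies in $\uparrow_{(\mathfrak A,\mathfrak B)}(a\to b:\cdot\,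 c\to d)$ for all $a,b\in A$, $c,d\in B$; let $\emptyset_{(\mathfrak A,\mathfrak B)}$ be the set of trivial c-formulas. We write $(\mathfrak A,\mathfrak B)\models a\to b:\cdot\, c\to d$ iff either (i) $\uparrow_{\mathfrak A}(a\to b)\cup\uparrow_{\mathfrak B}(c\to d)$ consists only of trivial formulas, or (ii) $\uparrow_{(\mathfrak A,\mathfrak B)}(a\to b:\cdot\, c\to d)$ contains a non-trivial formula and for every $d'\in B$: if $\emptyset_{(\mathfrak A,\mathfrak B)}\subsetneq \uparrow_{(\mathfrak A,\mathfrak B)}(a\to b:\cdot\, c\to d)\subseteq \uparrow_{(\mathfrak A,\mathfrak B)}(a\to b:\cdot\, c\to d')$ then $\emptyset_{(\mathfrak A,\mathfrak B)}\subsetneq\uparrow_{(\mathfrak A,\mathfrak B)}(a\to b:\cdot\, c\to d')\subseteq\uparrow_{(\mathfrak A,\mathfrak B)}(a\to b:\cdot\, c\to d)$. Finally $(\mathfrak A,\mathfrak B)\models a:b::c:d$ iff $(\mathfrak A,\mathfrak B)\models a\to b:\cdot\, c\to d$, $(\mathfrak A,\mathfrak B)\models b\to a:\cdot\, d\to c$, $(\mathfrak B,\mathfrak A)\models c\to d:\cdot\, a\to b$ and $(\mathfrak B,\mathfrak A)\models d\to c:\cdot\, b\to a$. We write $\mathfrak A\models\ldots$ for $(\mathfrak A,\mathfrak A)\models\ldots$.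
   Formalization: Inner p-reflexivity is false as stated when 𝔄 and 𝔅 are both one-element structures that interpret some relation symbol differently; it is proved here for all other pairs of structures 𝔄, 𝔅, and it fails for every excluded pair. -}

module Defs where

open import Data.List.Base using (List; []; _∷_; _++_; [_]; concatMap; filter)
open import Data.List.Membership.Propositional using () renaming (_∈_ to _∈ᴸ_; _∉_ to _∉ᴸ_)
open import Data.List.Membership.Propositional.Properties using (∈-++⁺ʳ; ∈-++⁻)
open import Data.List.Relation.Unary.Any using (here; there)
open import Data.List.Relation.Unary.Unique.Propositional using (Unique)
open import Data.List.Relation.Unary.AllPairs using ([])
open import Data.Nat.Base using (ℕ; zero; suc)
open import Data.Nat.Properties using (_≟_)
open import Data.Product.Base using (Σ-syntax; ∃-syntax; _×_; _,_; proj₁; proj₂)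
open import Data.Sum.Base using (_⊎_; inj₁; inj₂)
open import Data.Vec.Base using (Vec; []; _∷_; replicate)
open import Function.Bundles using (_⇔_; mk⇔)
open import Level using (0ℓ)
open import Relation.Binary.Construct.Closure.ReflexiveTransitive using (Star; ε; _◅_)
open import Relation.Binary.PropositionalEquality using (_≡_; refl; cong₂; subst; subst₂)
open import Relation.Nullary using (¬_; yes; no; ¬?)
open import Relation.Unary using (Pred; _∈_; _∉_; _∩_; _∪_; _⊆_; _⊂_)

record Language : Set₁ where
  field
    RelSym   : Set
    FunSym   : Set
    ConstSym : Set
    relArity : RelSym → ℕ
    funArity : FunSym → ℕ

open Language public

-- Non-emptiness of the carrier is not a field: all properties of proportions
-- below are about given elements of the structures involved.
record Structure (L : Language) : Set₁ where
  field
    Carrier : Set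
    relᴵ    : (R : RelSym L) → Vec Carrier (relArity L R) → Set
    funᴵ    : (f : FunSym L) → Vec Carrier (funArity L f) → Carrier
    constᴵ  : ConstSym L → Carrier

open Structure public

Var : Set
Var = ℕ

𝐱 𝐲 : Var
𝐱 = 0
𝐲 = 1

module _ (L : Language) where

  data Term : Set where
    var   : Var → Term
    const : ConstSym L → Term
    fun   : (f : FunSym L) → Vec Term (funArity L f) → Term

  data Atom : Set where
    rel : (R : RelSym L) → Vec Term (relArity L R) → Atom
    _≈_ : Term → Term → Atom

  data Formula : Set where
    atom : Atom → Formula
    _∧_  : Formula → Formula → Formula
    ex   : Var → Formula → Formula
    all  : Var → Formula → Formula

module _ {L : Language} where

  termVars  : Term L → List Var
  termsVars : ∀ {n} → Vec (Term L) n → List Var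

  termVars (var v)    = [ v ]
  termVars (const _)  = []
  termVars (fun _ ts) = termsVars ts

  termsVars []       = []
  termsVars (t ∷ ts) = termVars t ++ termsVars ts

  atomVars : Atom L → List Var
  atomVars (rel _ ts) = termsVars ts
  atomVars (s ≈ t)    = termVars s ++ termVars t

  atoms : Formula L → List (Atom L)
  atoms (atom a)  = [ a ]
  atoms (φ ∧ ψ)   = atoms φ ++ atoms ψ
  atoms (ex _ φ)  = atoms φ
  atoms (all _ φ) = atoms φ

  freeVars : Formula L → List Var
  freeVars (atom a)  = atomVars a
  freeVars (φ ∧ ψ)   = freeVars φ ++ freeVars ψ
  freeVars (ex v φ)  = filter (λ w → ¬? (w ≟ v)) (freeVars φ)
  freeVars (all v φ) = filter (λ w → ¬? (w ≟ v)) (freeVars φ)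

  -- One entry for each quantifier occurrence.
  boundVars : Formula L → List Var
  boundVars (atom _)  = []
  boundVars (φ ∧ ψ)   = boundVars φ ++ boundVars ψ
  boundVars (ex v φ)  = v ∷ boundVars φ
  boundVars (all v φ) = v ∷ boundVars φ

  -- A variable occurring only next to its quantifier counts as occurring.
  Vertex : Formula L → Pred Var 0ℓ
  Vertex φ v = v ∈ᴸ concatMap atomVars (atoms φ) ⊎ v ∈ᴸ boundVars φ

  Edge : Formula L → Var → Var → Set
  Edge φ w z = ∃[ a ] a ∈ᴸ atoms φ × w ∈ᴸ atomVars a × z ∈ᴸ atomVars a

  Connected : Formula L → Set
  Connected φ = ∀ {w z} → Vertex φ w → Vertex φ z → Star (Edge φ) w z

  record IsCFormula (φ : Formula L) : Set where
    field
      free-exactly   : ∀ v → v ∈ᴸ freeVars φ ⇔ (v ≡ 𝐱 ⊎ v ≡ 𝐲)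
      bound-distinct : Unique (boundVars φ)
      -- Without these, occurrences of a free and of a bound variable
      -- would be identified in the dependency graph.
      𝐱-not-bound    : 𝐱 ∉ᴸ boundVars φ
      𝐲-not-bound    : 𝐲 ∉ᴸ boundVars φ
      connected      : Connected φ

  module _ (𝔄 : Structure L) where

    Assignment : Set
    Assignment = Var → Carrier 𝔄

    _[_↦_] : Assignment → Var → Carrier 𝔄 → Assignment
    (ρ [ v ↦ a ]) w with w ≟ v
    ... | yes _ = a
    ... | no  _ = ρ w

    eval  : Assignment → Term L → Carrier 𝔄
    evals : Assignment → ∀ {n} → Vec (Term L) n → Vec (Carrier 𝔄) n

    eval ρ (var v)    = ρ v
    eval ρ (const c)  = constᴵ 𝔄 c
    eval ρ (fun f ts) = funᴵ 𝔄 f (evals ρ ts)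

    evals ρ []       = []
    evals ρ (t ∷ ts) = eval ρ t ∷ evals ρ ts

    Satᵃ : Assignment → Atom L → Set
    Satᵃ ρ (rel R ts) = relᴵ 𝔄 R (evals ρ ts)
    Satᵃ ρ (s ≈ t)    = eval ρ s ≡ eval ρ t

    Sat : Assignment → Formula L → Set
    Sat ρ (atom a)  = Satᵃ ρ a
    Sat ρ (φ ∧ ψ)   = Sat ρ φ × Sat ρ ψ
    Sat ρ (ex v φ)  = Σ[ a ∈ Carrier 𝔄 ] Sat (ρ [ v ↦ a ]) φ
    Sat ρ (all v φ) = (a : Carrier 𝔄) → Sat (ρ [ v ↦ a ]) φ

    -- 𝐱 ↦ a and 𝐲 ↦ b; the values at other variables are irrelevant for
    -- formulas whose free variables are 𝐱 and 𝐲.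
    pair : Carrier 𝔄 → Carrier 𝔄 → Assignment
    pair a b zero    = a
    pair a b (suc _) = b

    ↑ : Carrier 𝔄 → Carrier 𝔄 → Pred (Formula L) 0ℓ
    ↑ a b α = IsCFormula α × Sat (pair a b) α

  module _ (𝔄 𝔅 : Structure L) where

    Just : (a b : Carrier 𝔄) (c d : Carrier 𝔅) → Pred (Formula L) 0ℓ
    Just a b c d = ↑ 𝔄 a b ∩ ↑ 𝔅 c d

    Trivial : Pred (Formula L) 0ℓ
    Trivial α = IsCFormula α × (∀ a b c d → α ∈ Just a b c d)

    infix 3 ⟨_,_⟩⊨_⟶_:·_⟶_

    ⟨_,_⟩⊨_⟶_:·_⟶_ : (a b : Carrier 𝔄) (c d : Carrier 𝔅) → Set
    ⟨_,_⟩⊨_⟶_:·_⟶_ a b c d =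
        (↑ 𝔄 a b ∪ ↑ 𝔅 c d ⊆ Trivial)
      ⊎ ( (∃[ α ] α ∈ Just a b c d × α ∉ Trivial)
        × (∀ d′ → Trivial ⊂ Just a b c d × Just a b c d ⊆ Just a b c d′
                → Trivial ⊂ Just a b c d′ × Just a b c d′ ⊆ Just a b c d))

  infix 3 ⟨_,_⟩⊨_∶_∷∷_∶_

  ⟨_,_⟩⊨_∶_∷∷_∶_ : (𝔄 𝔅 : Structure L) (a b : Carrier 𝔄) (c d : Carrier 𝔅) → Set
  ⟨ 𝔄 , 𝔅 ⟩⊨ a ∶ b ∷∷ c ∶ d =
      (⟨ 𝔄 , 𝔅 ⟩⊨ a ⟶ b :· c ⟶ d)
    × (⟨ 𝔄 , 𝔅 ⟩⊨ b ⟶ a :· d ⟶ c)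
    × (⟨ 𝔅 , 𝔄 ⟩⊨ c ⟶ d :· a ⟶ b)
    × (⟨ 𝔅 , 𝔄 ⟩⊨ d ⟶ c :· b ⟶ a)

  infix 3 _⊨_∶_∷∷_∶_

  _⊨_∶_∷∷_∶_ : (𝔄 : Structure L) (a b c d : Carrier 𝔄) → Set
  𝔄 ⊨ a ∶ b ∷∷ c ∶ d = ⟨ 𝔄 , 𝔄 ⟩⊨ a ∶ b ∷∷ c ∶ d

  OneElement : Structure L → Set
  OneElement 𝔄 = (a b : Carrier 𝔄) → a ≡ b

  -- Two one-element structures that interpret some relation symbol
  -- differently.
  DistinctOneElement : Structure L → Structure L → Set
  DistinctOneElement 𝔄 𝔅 =
      OneElement 𝔄 × OneElement 𝔅
    × (∃[ R ] ∃[ us ] ∃[ vs ] ¬ (relᴵ 𝔄 R us ⇔ relᴵ 𝔅 R vs))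

  -- For such structures 𝐱 ≈ 𝐲 is trivial and a ∶ a ∷∷ c ∶ c is false, so inner
  -- p-reflexivity can only be claimed outside this case.
  module _ (𝔄 𝔅 : Structure L) where

    private
      α : RelSym L → Formula L
      α R = atom (rel R (replicate _ (var 𝐱))) ∧ atom (var 𝐱 ≈ var 𝐲)

      only-𝐱 : ∀ n {v} → v ∈ᴸ termsVars (replicate n (var 𝐱)) → v ≡ 𝐱
      only-𝐱 (suc n) (here p)  = p
      only-𝐱 (suc n) (there p) = only-𝐱 n p

      only : ∀ n {v} → v ∈ᴸ termsVars (replicate n (var 𝐱)) ++ 𝐱 ∷ 𝐲 ∷ [] → v ≡ 𝐱 ⊎ v ≡ 𝐲
      only n p with ∈-++⁻ (termsVars (replicate n (var 𝐱))) p
      ... | inj₁ q                = inj₁ (only-𝐱 n q)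
      ... | inj₂ (here q)         = inj₁ q
      ... | inj₂ (there (here q)) = inj₂ q

      in-𝐱≈𝐲 : ∀ {v} → v ≡ 𝐱 ⊎ v ≡ 𝐲 → v ∈ᴸ 𝐱 ∷ 𝐲 ∷ []
      in-𝐱≈𝐲 (inj₁ p) = here p
      in-𝐱≈𝐲 (inj₂ p) = there (here p)

      isC : ∀ R → IsCFormula (α R)
      isC R = record
        { free-exactly   = λ v → mk⇔ (only n)
            (λ p → ∈-++⁺ʳ (termsVars (replicate n (var 𝐱))) (in-𝐱≈𝐲 p))
        ; bound-distinct = []
        ; 𝐱-not-bound    = λ ()
        ; 𝐲-not-bound    = λ ()
        ; connected      = λ p q →
            (_ , there (here refl) , in-𝐱≈𝐲 (vertex p) , in-𝐱≈𝐲 (vertex q)) ◅ ε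
        }
        where
        n = relArity L R
        vertex : ∀ {v} → Vertex (α R) v → v ≡ 𝐱 ⊎ v ≡ 𝐲
        vertex (inj₁ p) = only n p

      vec-≡ : ∀ {ℭ : Structure L} → OneElement ℭ → ∀ {n} (us vs : Vec (Carrier ℭ) n) → us ≡ vs
      vec-≡ one []       []       = refl
      vec-≡ {ℭ} one (u ∷ us) (v ∷ vs) = cong₂ _∷_ (one u v) (vec-≡ {ℭ} one us vs)

    innerReflexivity-fails : DistinctOneElement 𝔄 𝔅 → ∀ a c → ¬ (⟨ 𝔄 , 𝔅 ⟩⊨ a ∶ a ∷∷ c ∶ c)
    innerReflexivity-fails (oneA , oneB , _) a c (inj₂ ((β , (β∈A , β∈B) , β∉) , _) , _) =
      β∉ (proj₁ β∈A , λ a₁ a₂ c₁ c₂ →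
           subst₂ (λ s t → β ∈ ↑ 𝔄 s t) (oneA a a₁) (oneA a a₂) β∈A
         , subst₂ (λ s t → β ∈ ↑ 𝔅 s t) (oneB c c₁) (oneB c c₂) β∈B)
    innerReflexivity-fails (oneA , oneB , R , us , vs , us≢vs) a c (inj₁ triv , _) =
      us≢vs (mk⇔
        (λ r → subst (relᴵ 𝔅 R) (vec-≡ {𝔅} oneB _ vs) (proj₁ (proj₂ (proj₂ (proj₂
          (triv {α R} (inj₁ (isC R , subst (relᴵ 𝔄 R) (vec-≡ {𝔄} oneA us _) r , refl))) a a c c)))))
        (λ r → subst (relᴵ 𝔄 R) (vec-≡ {𝔄} oneA _ us) (proj₁ (proj₂ (proj₁ (proj₂
          (triv {α R} (inj₂ (isC R , subst (relᴵ 𝔅 R) (vec-≡ {𝔅} oneB vs _) r , refl))) a a c c))))))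

{-# OPTIONS --safe #-}

-- c-formulas are positive, hence preserved by surjective homomorphisms; so pairs
-- exchanged by an isomorphism have the same c-formulas and are proportional.
-- Moreover, a nontrivial justification satisfied by (c , d) but by no other
-- (c , d′) is enough for a ⟶ b :· c ⟶ d.  All counterexamples live on a
-- three-element set with permutations as unary functions.
module Submission where

open import Defs
open import Axiom.ExcludedMiddle using (ExcludedMiddle)
open import Data.Bool.Base using (Bool; true; false; if_then_else_)
open import Data.Empty using (⊥)
open import Data.Fin.Base using (Fin)
open import Data.Fin.Patterns using (0F; 1F; 2F)
open import Data.Fin.Permutation using (Permutation′; transpose; _∘ₚ_; _⟨$⟩ʳ_)
open import Data.List.Base using ([]; _∷_)
open import Data.List.Membership.Propositional using () renaming (_∈_ to _∈ᴸ_)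
open import Data.List.Properties using (++-identityʳ)
open import Data.List.Relation.Unary.AllPairs using ([])
open import Data.List.Relation.Unary.Any using (here; there)
open import Data.Nat.Base using (zero; suc)
open import Data.Nat.Properties using (_≟_)
open import Data.Product.Base using (Σ-syntax; ∃-syntax; _×_; _,_; proj₁; proj₂; map₂; swap)
open import Data.Sum.Base using (_⊎_; inj₁; inj₂)
open import Data.Unit.Base using (⊤; tt)
open import Data.Vec.Base as Vec using (Vec; []; _∷_)
open import Function.Base using (_∘_)
open import Function.Bundles using (_⇔_; _↣_; _↔_; Injection; Inverse; Equivalence; mk⇔)
open import Function.Construct.Identity using (↣-id)
open import Function.Construct.Symmetry using (⇔-sym)
open import Function.Properties.Inverse using (↔-sym; Inverse⇒Injection)
open import Level using (0ℓ)
open import Relation.Binary.Construct.Closure.ReflexiveTransitive using (ε; _◅_)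
open import Relation.Binary.PropositionalEquality
  using (_≡_; _≢_; refl; sym; trans; cong; cong₂; subst; subst₂)
open import Relation.Nullary using (¬_; yes; no; contradiction)
open import Relation.Nullary.Decidable using (decidable-stable)
open import Relation.Unary using (_∈_; _∉_; _∪_; _⊆_; _≐_)

private
  variable
    L : Language

-- Atomic c-formulas

atom-isCFormula : (α : Atom L) → atomVars α ≡ 𝐱 ∷ 𝐲 ∷ [] → IsCFormula (atom α)
atom-isCFormula α vars = record
  { free-exactly   = λ v → mk⇔ (from-vars ∘ subst (v ∈ᴸ_) vars) (subst (v ∈ᴸ_) (sym vars) ∘ to-vars)
  ; bound-distinct = []
  ; 𝐱-not-bound    = λ ()
  ; 𝐲-not-bound    = λ ()
  -- All variables lie in the single atom `α`, so one edge joins any two vertices.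
  ; connected      = λ p q → (α , here refl , vertex p , vertex q) ◅ ε
  }
  where
  from-vars : ∀ {v} → v ∈ᴸ 𝐱 ∷ 𝐲 ∷ [] → v ≡ 𝐱 ⊎ v ≡ 𝐲
  from-vars (here p)         = inj₁ p
  from-vars (there (here p)) = inj₂ p

  to-vars : ∀ {v} → v ≡ 𝐱 ⊎ v ≡ 𝐲 → v ∈ᴸ 𝐱 ∷ 𝐲 ∷ []
  to-vars (inj₁ p) = here p
  to-vars (inj₂ p) = there (here p)

  vertex : ∀ {v} → Vertex (atom α) v → v ∈ᴸ atomVars α
  vertex {v} (inj₁ p) = subst (v ∈ᴸ_) (++-identityʳ (atomVars α)) p

x≈y : Formula L
x≈y = atom (var 𝐱 ≈ var 𝐲)

x≈y-isCFormula : IsCFormula {L} x≈y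
x≈y-isCFormula = atom-isCFormula (var 𝐱 ≈ var 𝐲) refl

x≈y∈↑ : (𝔄 : Structure L) (a : Carrier 𝔄) → x≈y ∈ ↑ 𝔄 a a
x≈y∈↑ 𝔄 a = x≈y-isCFormula , refl

-- Surjective homomorphisms and positive formulas

record IsSurjectiveHom (𝔄 𝔅 : Structure L) (h : Carrier 𝔄 → Carrier 𝔅) : Set where
  field
    surjective : ∀ b → ∃[ a ] h a ≡ b
    rel-hom    : ∀ R us → relᴵ 𝔄 R us → relᴵ 𝔅 R (Vec.map h us)
    fun-hom    : ∀ f us → h (funᴵ 𝔄 f us) ≡ funᴵ 𝔅 f (Vec.map h us)
    const-hom  : ∀ c → h (constᴵ 𝔄 c) ≡ constᴵ 𝔅 c

module _ {𝔄 𝔅 : Structure L} {h : Carrier 𝔄 → Carrier 𝔅} (hom : IsSurjectiveHom 𝔄 𝔅 h) where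
  open IsSurjectiveHom hom

  private
    infix 4 _↝_
    _↝_ : Assignment 𝔄 → Assignment 𝔅 → Set
    ρ ↝ σ = ∀ v → h (ρ v) ≡ σ v

  update-hom : ∀ {ρ σ} → ρ ↝ σ → ∀ v {a b} → h a ≡ b → _[_↦_] 𝔄 ρ v a ↝ _[_↦_] 𝔅 σ v b
  update-hom ρ↝σ v a↝b w with w ≟ v
  ... | yes _ = a↝b
  ... | no  _ = ρ↝σ w

  eval-hom  : ∀ {ρ σ} → ρ ↝ σ → ∀ t → h (eval 𝔄 ρ t) ≡ eval 𝔅 σ t
  evals-hom : ∀ {ρ σ} → ρ ↝ σ → ∀ {n} (ts : Vec _ n) →
              Vec.map h (evals 𝔄 ρ ts) ≡ evals 𝔅 σ ts

  eval-hom ρ↝σ (var v)    = ρ↝σ v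
  eval-hom ρ↝σ (const c)  = const-hom c
  eval-hom ρ↝σ (fun f ts) = trans (fun-hom f _) (cong (funᴵ 𝔅 f) (evals-hom ρ↝σ ts))

  evals-hom ρ↝σ []       = refl
  evals-hom ρ↝σ (t ∷ ts) = cong₂ _∷_ (eval-hom ρ↝σ t) (evals-hom ρ↝σ ts)

  Sat-hom : ∀ {ρ σ} → ρ ↝ σ → ∀ φ → Sat 𝔄 ρ φ → Sat 𝔅 σ φ
  Sat-hom ρ↝σ (atom (rel R ts)) r = subst (relᴵ 𝔅 R) (evals-hom ρ↝σ ts) (rel-hom R _ r)
  Sat-hom ρ↝σ (atom (s ≈ t)) e =
    trans (sym (eval-hom ρ↝σ s)) (trans (cong h e) (eval-hom ρ↝σ t))
  Sat-hom ρ↝σ (φ ∧ ψ) (p , q) = Sat-hom ρ↝σ φ p , Sat-hom ρ↝σ ψ q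
  Sat-hom ρ↝σ (ex v φ) (a , p) = h a , Sat-hom (update-hom ρ↝σ v refl) φ p
  -- Surjectivity enters here: the value `b` is pulled back to a preimage, at which the hypothesis
  -- is applied.
  Sat-hom ρ↝σ (all v φ) p b =
    let a , ha≡b = surjective b in Sat-hom (update-hom ρ↝σ v ha≡b) φ (p a)

  ↑-hom : ∀ a b → ↑ 𝔄 a b ⊆ ↑ 𝔅 (h a) (h b)
  ↑-hom a b {φ} = map₂ (Sat-hom pair-hom φ)
    where
    pair-hom : pair 𝔄 a b ↝ pair 𝔅 (h a) (h b)
    pair-hom zero    = refl
    pair-hom (suc _) = refl

-- Criteria for and against an arrow proportion

module _ {𝔄 𝔅 : Structure L} {a b : Carrier 𝔄} {c d : Carrier 𝔅} where

  -- Excluded middle decides between the two clauses of the definition: either both types are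
  -- trivial, or a nontrivial formula in one of them lies in the other too and is a justification.
  equal-types⇒⟶ : ExcludedMiddle 0ℓ → ↑ 𝔄 a b ≐ ↑ 𝔅 c d → ⟨ 𝔄 , 𝔅 ⟩⊨ a ⟶ b :· c ⟶ d
  equal-types⇒⟶ em (ab⊆cd , cd⊆ab) with em {∃[ α ] α ∈ ↑ 𝔄 a b ∪ ↑ 𝔅 c d × α ∉ Trivial 𝔄 𝔅}
  ... | no  none = inj₁ λ α∈ → decidable-stable em λ α∉ → none (_ , α∈ , α∉)
  ... | yes (α , α∈ , α∉) = inj₂ ((α , both α∈ , α∉) , maximal)
    where
    both : ∀ {β} → β ∈ ↑ 𝔄 a b ∪ ↑ 𝔅 c d → β ∈ Just 𝔄 𝔅 a b c d
    both (inj₁ p) = p , ab⊆cd p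
    both (inj₂ p) = cd⊆ab p , p

    maximal : ∀ d′ → _
    maximal d′ ((triv⊆ , ⊈triv) , J⊆J′) =
      ((λ {β} t → J⊆J′ (triv⊆ t)) , λ J′⊆triv → ⊈triv (λ {β} j → J′⊆triv (J⊆J′ j)))
      -- Whatever `d′` is, its justifications lie in `↑ 𝔄 a b`, and all of that set already
      -- justifies `d`.
      , λ {β} j′ → both (inj₁ (proj₁ j′))

  -- A competitor `d′` with at least the justifications of `d` satisfies `α`, hence equals `d`, and
  -- maximality becomes immediate.
  characteristic⇒⟶ : ∀ {α} → α ∈ Just 𝔄 𝔅 a b c d → α ∉ Trivial 𝔄 𝔅 →
                      (∀ d′ → α ∈ ↑ 𝔅 c d′ → d ≡ d′) → ⟨ 𝔄 , 𝔅 ⟩⊨ a ⟶ b :· c ⟶ d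
  characteristic⇒⟶ {α} α∈ α∉ unique = inj₂ ((α , α∈ , α∉) , maximal)
    where
    maximal : ∀ d′ → _
    maximal d′ (triv⊂ , J⊆J′) with refl ← unique d′ (proj₂ (J⊆J′ α∈)) = triv⊂ , λ {β} j → j

  -- The inclusion gives Just a b c d ⊆ Just a b c d′, and α makes it strict.
  better-match⇒¬⟶ : ∀ {d′ α} → ↑ 𝔄 a b ⊆ ↑ 𝔅 c d′ → α ∈ ↑ 𝔄 a b → α ∉ ↑ 𝔅 c d →
                     ¬ (⟨ 𝔄 , 𝔅 ⟩⊨ a ⟶ b :· c ⟶ d)
  better-match⇒¬⟶ ab⊆cd′ α∈ α∉ (inj₁ triv) = α∉ (proj₂ (proj₂ (triv (inj₁ α∈)) a b c d))
  better-match⇒¬⟶ {d′} ab⊆cd′ α∈ α∉ (inj₂ ((β , β∈ , β∉) , maximal)) =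
    α∉ (proj₂ (proj₂ (maximal d′
      (((λ {γ} t → proj₂ t a b c d) , λ J⊆triv → β∉ (J⊆triv β∈))
      , λ {γ} j → proj₁ j , ab⊆cd′ (proj₁ j)))
      (α∈ , ab⊆cd′ α∈)))

equal-types⇒∷∷ : ∀ {𝔄 𝔅 : Structure L} {a b c d} → ExcludedMiddle 0ℓ →
                 ↑ 𝔄 a b ≐ ↑ 𝔅 c d → ↑ 𝔄 b a ≐ ↑ 𝔅 d c → ⟨ 𝔄 , 𝔅 ⟩⊨ a ∶ b ∷∷ c ∶ d
equal-types⇒∷∷ {𝔄 = 𝔄} {𝔅} em ab≐cd ba≐dc =
    equal-types⇒⟶ {𝔄 = 𝔄} {𝔅} em ab≐cd
  , equal-types⇒⟶ {𝔄 = 𝔄} {𝔅} em ba≐dc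
  , equal-types⇒⟶ {𝔄 = 𝔅} {𝔄} em (swap ab≐cd)
  , equal-types⇒⟶ {𝔄 = 𝔅} {𝔄} em (swap ba≐dc)

-- The positive properties

p-symmetry : ∀ (𝔄 𝔅 : Structure L) {a b c d} →
             ⟨ 𝔄 , 𝔅 ⟩⊨ a ∶ b ∷∷ c ∶ d → ⟨ 𝔅 , 𝔄 ⟩⊨ c ∶ d ∷∷ a ∶ b
p-symmetry _ _ (p , q , r , s) = r , s , p , q

inner-p-symmetry : ∀ (𝔄 𝔅 : Structure L) {a b c d} →
                   ⟨ 𝔄 , 𝔅 ⟩⊨ a ∶ b ∷∷ c ∶ d → ⟨ 𝔄 , 𝔅 ⟩⊨ b ∶ a ∷∷ d ∶ c
inner-p-symmetry _ _ (p , q , r , s) = q , p , s , r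

-- Equations in a one-element target hold automatically, so only the relations impose a condition;
-- the element of `𝔄` serves as preimage.
one-element-hom : ∀ {𝔄 𝔅 : Structure L} → OneElement 𝔅 →
                  (∀ R us vs → relᴵ 𝔄 R us → relᴵ 𝔅 R vs) →
                  Carrier 𝔄 → (c : Carrier 𝔅) → IsSurjectiveHom 𝔄 𝔅 (λ _ → c)
one-element-hom one rels a c = record
  { surjective = λ b → a , one c b
  ; rel-hom    = λ R us → rels R us _
  ; fun-hom    = λ _ _ → one _ _
  ; const-hom  = λ _ → one _ _
  }

-- If `x≈y` is nontrivial, it characterises `c` as partner of `c`. If it is trivial, both structures
-- have one element; not being distinct, they agree on all relations, so the constant maps both ways
-- are surjective homomorphisms and the types coincide.
inner-reflexivity-⟶ : ExcludedMiddle 0ℓ → (𝔄 𝔅 : Structure L) → ¬ DistinctOneElement 𝔄 𝔅 →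
                       ∀ a c → ⟨ 𝔄 , 𝔅 ⟩⊨ a ⟶ a :· c ⟶ c
inner-reflexivity-⟶ em 𝔄 𝔅 ¬distinct a c with em {x≈y ∈ Trivial 𝔄 𝔅}
... | no nontrivial = characteristic⇒⟶ {𝔄 = 𝔄} {𝔅} (x≈y∈↑ 𝔄 a , x≈y∈↑ 𝔅 c) nontrivial (λ _ → proj₂)
... | yes (_ , trivial) = equal-types⇒⟶ {𝔄 = 𝔄} {𝔅} em
  ( ↑-hom (one-element-hom oneB (λ R us vs → Equivalence.to (rels R us vs)) a c) a a
  , ↑-hom (one-element-hom oneA (λ R vs us → Equivalence.from (rels R us vs)) c a) c c )
  where
  oneA : OneElement 𝔄
  oneA s t = proj₂ (proj₁ (trivial s t c c))

  oneB : OneElement 𝔅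
  oneB s t = proj₂ (proj₂ (trivial a a s t))

  rels : ∀ R us vs → relᴵ 𝔄 R us ⇔ relᴵ 𝔅 R vs
  rels R us vs = decidable-stable em λ ¬eq → ¬distinct (oneA , oneB , R , us , vs , ¬eq)

inner-p-reflexivity : ExcludedMiddle 0ℓ → (𝔄 𝔅 : Structure L) → ¬ DistinctOneElement 𝔄 𝔅 →
                      ∀ a c → ⟨ 𝔄 , 𝔅 ⟩⊨ a ∶ a ∷∷ c ∶ c
inner-p-reflexivity em 𝔄 𝔅 ¬distinct a c = ac , ac , ca , ca
  where
  ac = inner-reflexivity-⟶ em 𝔄 𝔅 ¬distinct a c
  ca = inner-reflexivity-⟶ em 𝔅 𝔄
    (λ (oneB , oneA , R , vs , us , ¬eq) → ¬distinct (oneA , oneB , R , us , vs , ¬eq ∘ ⇔-sym)) c a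

p-reflexivity : ExcludedMiddle 0ℓ → (𝔄 : Structure L) → ∀ a b → 𝔄 ⊨ a ∶ b ∷∷ a ∶ b
p-reflexivity em 𝔄 a b = equal-types⇒∷∷ {𝔄 = 𝔄} {𝔄} em ((λ p → p) , λ p → p) ((λ p → p) , λ p → p)

p-determinism : ExcludedMiddle 0ℓ → (𝔄 : Structure L) → ∀ a d → (𝔄 ⊨ a ∶ a ∷∷ a ∶ d) ⇔ d ≡ a
p-determinism em 𝔄 a d = mk⇔
  -- For `d` different from `a`, the element `a` itself is the better match: `x≈y` holds at
  -- `(a , a)` but not at `(a , d)`.
  (λ p → decidable-stable em λ d≢a →
    better-match⇒¬⟶ {𝔄 = 𝔄} {𝔄} (λ q → q) (x≈y∈↑ 𝔄 a) (d≢a ∘ sym ∘ proj₂) (proj₁ p))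
  (λ { refl → p-reflexivity em 𝔄 a a })

-- Unary algebras: automorphisms and injective operations

unary : Set → Language
unary I = record
  { RelSym   = ⊥
  ; FunSym   = I
  ; ConstSym = ⊥
  ; relArity = λ ()
  ; funArity = λ _ → 1
  }

module _ {I : Set} where

  -- Both express the graph of one operation, read in opposite directions; `x≈fy` serves the
  -- reversed arrows of a proportion.
  fx≈y x≈fy : I → Formula (unary I)
  fx≈y i = atom (fun i (var 𝐱 ∷ []) ≈ var 𝐲)
  x≈fy i = atom (var 𝐱 ≈ fun i (var 𝐲 ∷ []))

  fx≈y-isCFormula : ∀ i → IsCFormula (fx≈y i)
  fx≈y-isCFormula i = atom-isCFormula (fun i (var 𝐱 ∷ []) ≈ var 𝐲) refl

  x≈fy-isCFormula : ∀ i → IsCFormula (x≈fy i)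
  x≈fy-isCFormula i = atom-isCFormula (var 𝐱 ≈ fun i (var 𝐲 ∷ [])) refl

module _ {I X : Set} (F : I → X → X) where

  algebra : Structure (unary I)
  algebra = record
    { Carrier = X
    ; relᴵ    = λ ()
    ; funᴵ    = λ { i (x ∷ []) → F i x }
    ; constᴵ  = λ ()
    }

  equivariant⇒hom : (π : X ↔ X) → let open Inverse π in (∀ i x → to (F i x) ≡ F i (to x)) →
                    IsSurjectiveHom algebra algebra to
  equivariant⇒hom π equivariant = record
    { surjective = λ y → from y , strictlyInverseˡ y
    ; rel-hom    = λ ()
    ; fun-hom    = λ { i (x ∷ []) → equivariant i x }
    ; const-hom  = λ ()
    }
    where open Inverse π

  module _ (π : X ↔ X) (equivariant : ∀ i x → Inverse.to π (F i x) ≡ F i (Inverse.to π x)) where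
    open Inverse π

    -- The inverse of an equivariant bijection is equivariant as well, so c-formulas transfer in
    -- both directions.
    automorphism⇒≐ : ∀ a b → ↑ algebra a b ≐ ↑ algebra (to a) (to b)
    automorphism⇒≐ a b =
        ↑-hom (equivariant⇒hom π equivariant) a b
      , λ {φ} p → subst₂ (λ s t → φ ∈ ↑ algebra s t) (strictlyInverseʳ a) (strictlyInverseʳ b)
          (↑-hom (equivariant⇒hom (↔-sym π) from-equivariant) (to a) (to b) p)
      where
      from-equivariant : ∀ i x → from (F i x) ≡ F i (from x)
      from-equivariant i x = trans (cong (from ∘ F i) (sym (strictlyInverseˡ x)))
        (trans (cong from (sym (equivariant i (from x)))) (strictlyInverseʳ _))

    automorphism⇒∷∷ : ExcludedMiddle 0ℓ → ∀ a b → algebra ⊨ a ∶ b ∷∷ to a ∶ to b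
    automorphism⇒∷∷ em a b =
      equal-types⇒∷∷ {𝔄 = algebra} {algebra} em (automorphism⇒≐ a b) (automorphism⇒≐ b a)

  module _ {i : I} (injective : ∀ {x y} → F i x ≡ F i y → x ≡ y) {p q : X} (p≢q : p ≢ q) where

    -- The equation `fx≈y i` determines the image from the argument, and by injectivity `x≈fy i`
    -- determines the argument from the image.
    injective⇒∷∷ : ∀ a c → algebra ⊨ a ∶ F i a ∷∷ c ∶ F i c
    injective⇒∷∷ a c = forward a c , backward a c , forward c a , backward c a
      where
      forward : ∀ a c → ⟨ algebra , algebra ⟩⊨ a ⟶ F i a :· c ⟶ F i c
      forward a c = characteristic⇒⟶ {𝔄 = algebra} {algebra} {α = fx≈y i}
        ((fx≈y-isCFormula i , refl) , fx≈y-isCFormula i , refl)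
        -- Triviality would make `F i p` equal to both `p` and `q`.
        (λ (_ , t) → p≢q (trans (sym (proj₂ (proj₁ (t p p p p)))) (proj₂ (proj₁ (t p q p p)))))
        (λ _ → proj₂)

      backward : ∀ a c → ⟨ algebra , algebra ⟩⊨ F i a ⟶ a :· F i c ⟶ c
      backward a c = characteristic⇒⟶ {𝔄 = algebra} {algebra} {α = x≈fy i}
        ((x≈fy-isCFormula i , refl) , x≈fy-isCFormula i , refl)
        (λ (_ , t) → p≢q (trans (proj₂ (proj₁ (t p p p p))) (sym (proj₂ (proj₁ (t q p p p))))))
        (λ _ → injective ∘ proj₂)

-- Counterexamples on three elements

permutation-injective : ∀ {n} (π : Permutation′ n) {x y} → π ⟨$⟩ʳ x ≡ π ⟨$⟩ʳ y → x ≡ y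
permutation-injective π = Injection.injective (Inverse⇒Injection π)

0≢1 : _≢_ {A = Fin 3} 0F 1F
0≢1 ()

swap₀₁ swap₁₂ cycle : Permutation′ 3
swap₀₁ = transpose 0F 1F
swap₁₂ = transpose 1F 2F
-- The left factor acts first, so 0 goes to 1, 1 to 2 and 2 to 0.
cycle  = swap₁₂ ∘ₚ swap₀₁

pureSet : Structure (unary ⊥)
pureSet = algebra {X = Fin 3} λ ()

swapped : Structure (unary ⊤)
swapped = algebra λ _ → swap₁₂ ⟨$⟩ʳ_

cyclic : Structure (unary ⊤)
cyclic = algebra λ _ → cycle ⟨$⟩ʳ_

-- Two operations in one algebra allow the two premises of central transitivity to be justified by
-- different ones.
swap-or-cycle : Bool → Fin 3 → Fin 3
swap-or-cycle b = (if b then swap₀₁ else cycle) ⟨$⟩ʳ_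

-- The operation fixes 0 and sends 1 to 2, so one equation relates a fixed point to a moved one.
swapped-0∶0∷∷1∶2 : swapped ⊨ 0F ∶ 0F ∷∷ 1F ∶ 2F
swapped-0∶0∷∷1∶2 = injective⇒∷∷ _ (permutation-injective swap₁₂) 0≢1 0F 1F

module _ (em : ExcludedMiddle 0ℓ) where

  pureSet-∷∷ : (π : Permutation′ 3) → ∀ a b → pureSet ⊨ a ∶ b ∷∷ π ⟨$⟩ʳ a ∶ π ⟨$⟩ʳ b
  pureSet-∷∷ π = automorphism⇒∷∷ _ π (λ ()) em

  not-central-permutation : ¬ ((pureSet ⊨ 0F ∶ 1F ∷∷ 0F ∶ 2F) ⇔ (pureSet ⊨ 0F ∶ 0F ∷∷ 1F ∶ 2F))
  not-central-permutation eq =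
    -- Exchanging 0 and 1 gives `(1 , 1)` the type of `(0 , 0)`, which contains `x≈y`; the pair
    -- `(1 , 2)` violates it.
    better-match⇒¬⟶ {𝔄 = pureSet} {pureSet} {d′ = 1F}
      (proj₁ (automorphism⇒≐ _ swap₀₁ (λ ()) 0F 0F)) (x≈y∈↑ pureSet 0F) (λ { (_ , ()) })
      (proj₁ (Equivalence.to eq (pureSet-∷∷ swap₁₂ 0F 1F)))

  swapped-0∶1∷∷0∶2 : swapped ⊨ 0F ∶ 1F ∷∷ 0F ∶ 2F
  -- The operation commutes with itself and so is an automorphism; it fixes 0.
  swapped-0∶1∷∷0∶2 = automorphism⇒∷∷ _ swap₁₂ (λ _ _ → refl) em 0F 1F

  not-p-commutativity : ¬ (cyclic ⊨ 0F ∶ 1F ∷∷ 1F ∶ 0F)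
  not-p-commutativity =
    -- The cycle is an automorphism taking `(0 , 1)` to `(1 , 2)`, so 2 beats 0, which is not the
    -- image of 1.
    better-match⇒¬⟶ {𝔄 = cyclic} {cyclic} {d′ = 2F} {α = fx≈y tt}
      (proj₁ (automorphism⇒≐ _ cycle (λ _ _ → refl) 0F 1F))
      (fx≈y-isCFormula tt , refl) (λ { (_ , ()) }) ∘ proj₁

  not-1∶1∷∷1∶2 : ¬ (swapped ⊨ 1F ∶ 1F ∷∷ 1F ∶ 2F)
  not-1∶1∷∷1∶2 p = contradiction (Equivalence.to (p-determinism em swapped 1F 2F) p) λ ()

  not-0∶0∷∷0∶1 : ¬ (pureSet ⊨ 0F ∶ 0F ∷∷ 0F ∶ 1F)
  not-0∶0∷∷0∶1 p = contradiction (Equivalence.to (p-determinism em pureSet 0F 1F) p) λ ()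

not-1∶0∷∷1∶2 : ¬ (algebra swap-or-cycle ⊨ 1F ∶ 0F ∷∷ 1F ∶ 2F)
not-1∶0∷∷1∶2 =
  better-match⇒¬⟶ {𝔄 = algebra swap-or-cycle} {algebra swap-or-cycle} {α = fx≈y true}
    (λ p → p) (fx≈y-isCFormula true , refl) (λ { (_ , ()) }) ∘ proj₁

theorem4 : ExcludedMiddle 0ℓ →
    (∀ {L} (𝔄 𝔅 : Structure L) a b c d →
    (⟨ 𝔄 , 𝔅 ⟩⊨ a ∶ b ∷∷ c ∶ d) ⇔ (⟨ 𝔅 , 𝔄 ⟩⊨ c ∶ d ∷∷ a ∶ b))
    × (∀ {L} (𝔄 𝔅 : Structure L) a b c d →
    (⟨ 𝔄 , 𝔅 ⟩⊨ a ∶ b ∷∷ c ∶ d) ⇔ (⟨ 𝔄 , 𝔅 ⟩⊨ b ∶ a ∷∷ d ∶ c))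
    × (∀ {L} (𝔄 𝔅 : Structure L) → ¬ DistinctOneElement 𝔄 𝔅 → ∀ a c →
    ⟨ 𝔄 , 𝔅 ⟩⊨ a ∶ a ∷∷ c ∶ c)
    × (∀ {L} (𝔄 : Structure L) a b → 𝔄 ⊨ a ∶ b ∷∷ a ∶ b)
    × (∀ {L} (𝔄 : Structure L) a d → (𝔄 ⊨ a ∶ a ∷∷ a ∶ d) ⇔ d ≡ a)
    × (∃[ L ] Σ[ 𝔄 ∈ Structure L ] ∃[ a ] ∃[ b ] ∃[ c ] ∃[ d ]
    ¬ ((𝔄 ⊨ a ∶ b ∷∷ c ∶ d) ⇔ (𝔄 ⊨ a ∶ c ∷∷ b ∶ d)))
    × (∃[ L ] Σ[ 𝔄 ∈ Structure L ] ∃[ a ] ∃[ c ] ∃[ d ]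
    (𝔄 ⊨ a ∶ a ∷∷ c ∶ d) × d ≢ c)
    × (∃[ L ] Σ[ 𝔄 ∈ Structure L ] ∃[ a ] ∃[ b ] ∃[ d ]
    (𝔄 ⊨ a ∶ b ∷∷ a ∶ d) × d ≢ b)
    × (∃[ L ] Σ[ 𝔄 ∈ Structure L ] ∃[ a ] ∃[ b ]
    ¬ (𝔄 ⊨ a ∶ b ∷∷ b ∶ a))
    × (∃[ L ] Σ[ 𝔄 ∈ Structure L ] Σ[ 𝔅 ∈ Structure L ] Σ[ ℭ ∈ Structure L ]
    ∃[ a ] ∃[ b ] ∃[ c ] ∃[ d ] ∃[ e ] ∃[ f ]
    (⟨ 𝔄 , 𝔅 ⟩⊨ a ∶ b ∷∷ c ∶ d) × (⟨ 𝔅 , ℭ ⟩⊨ c ∶ d ∷∷ e ∶ f)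
    × ¬ (⟨ 𝔄 , ℭ ⟩⊨ a ∶ b ∷∷ e ∶ f))
    × (∃[ L ] Σ[ 𝔄 ∈ Structure L ] Σ[ 𝔅 ∈ Structure L ]
    ∃[ a ] ∃[ b ] ∃[ e ] ∃[ c ] ∃[ d ] ∃[ f ]
    (⟨ 𝔄 , 𝔅 ⟩⊨ a ∶ b ∷∷ c ∶ d) × (⟨ 𝔄 , 𝔅 ⟩⊨ b ∶ e ∷∷ d ∶ f)
    × ¬ (⟨ 𝔄 , 𝔅 ⟩⊨ a ∶ e ∷∷ c ∶ f))
    × (∃[ L ] Σ[ 𝔄 ∈ Structure L ] Σ[ 𝔅 ∈ Structure L ] Σ[ ℭ ∈ Structure L ]
    Σ[ U ∈ Set ] Σ[ ι ∈ Carrier 𝔄 ↣ U ] Σ[ κ ∈ Carrier 𝔅 ↣ U ] Σ[ μ ∈ Carrier ℭ ↣ U ]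
    ∃[ a ] ∃[ b ] ∃[ b′ ] ∃[ c ] ∃[ c′ ] ∃[ d ]
    Injection.to ι b ≡ Injection.to κ b′ × Injection.to κ c ≡ Injection.to μ c′
    × (⟨ 𝔄 , 𝔅 ⟩⊨ a ∶ b ∷∷ b′ ∶ c) × (⟨ 𝔅 , ℭ ⟩⊨ b′ ∶ c ∷∷ c′ ∶ d)
    × ¬ (⟨ 𝔄 , ℭ ⟩⊨ a ∶ b ∷∷ c′ ∶ d))
theorem4 em =
    (λ 𝔄 𝔅 _ _ _ _ → mk⇔ (p-symmetry 𝔄 𝔅) (p-symmetry 𝔅 𝔄))
  , (λ 𝔄 𝔅 _ _ _ _ → mk⇔ (inner-p-symmetry 𝔄 𝔅) (inner-p-symmetry 𝔄 𝔅))
  , inner-p-reflexivity em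
  , p-reflexivity em
  , p-determinism em
  , (_ , pureSet , 0F , 1F , 0F , 2F , not-central-permutation em)
  , (_ , swapped , 0F , 1F , 2F , swapped-0∶0∷∷1∶2 , λ ())
  , (_ , swapped , 0F , 1F , 2F , swapped-0∶1∷∷0∶2 em , λ ())
  , (_ , cyclic , 0F , 1F , not-p-commutativity em)
  -- The chain 1:1::0:0::1:2 would give 1:1::1:2, against determinism.
  , (_ , swapped , swapped , swapped , 1F , 1F , 0F , 0F , 1F , 2F
    , inner-p-reflexivity em swapped swapped (λ (one , _) → 0≢1 (one 0F 1F)) 1F 0F
    , swapped-0∶0∷∷1∶2 , not-1∶1∷∷1∶2 em)
  -- Different automorphisms justify the premises 0:1::0:2 and 1:0::2:1; the conclusion 0:0::0:1
  -- contradicts determinism.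
  , (_ , pureSet , pureSet , 0F , 1F , 0F , 0F , 2F , 1F
    , pureSet-∷∷ em swap₁₂ 0F 1F , pureSet-∷∷ em cycle 1F 0F , not-0∶0∷∷0∶1 em)
  -- The swap yields 1:0::0:1 and the cycle 0:1::1:2, but in 1:0::1:2 the swap, sending 1 to 0,
  -- favours 0 over 2.
  , (_ , algebra swap-or-cycle , algebra swap-or-cycle , algebra swap-or-cycle
    , Fin 3 , ↣-id _ , ↣-id _ , ↣-id _ , 1F , 0F , 0F , 1F , 1F , 2F , refl , refl
    , injective⇒∷∷ swap-or-cycle {true} (permutation-injective swap₀₁) 0≢1 1F 0F
    , injective⇒∷∷ swap-or-cycle {false} (permutation-injective cycle) 0≢1 0F 1F
    , not-1∶0∷∷1∶2)
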